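{- For every level $t \in \mathcal{L}$ there exists a unique finite set $\{u_1, \ldots, u_n\} \subseteq \mathcal{L}_s$ of pairwise incomparable sublevels (i.e. with $\max(u_1,\ldots,u_n) \in \mathcal{L}_r$) such that $t =_{\mathcal{L}} \max(u_1, \ldots, u_n)$.
   Context: $\operatorname{imax}\colon \mathbb{N}\times\mathbb{N}\to\mathbb{N}$ is defined by $\operatorname{imax}(i,0)=0$ and $\operatorname{imax}(i,j+1)=\max(i,j+1)$. Levels are terms of the grammar $t ::= x \mid 0 \mid s(t) \mid \max(t,t) \mid \operatorname{imax}(t,t)$, with $x$ in a countable set of variables $\mathcal{X}$; $\mathcal{L}$ is the set of levels. A valuation is $\sigma\colon\mathcal{X}\to\mathbb{N}$; values are $[0]_\sigma=0$, $[x]_\sigma=\sigma(x)$, $[s(t)]_\sigma=[t]_\sigma+1$, $[\max(t_1,t_2)]_\sigma=\max([t_1]_\sigma,[t_2]_\sigma)$, $[\operatorname{imax}(t_1,t_2)]_\sigma=\operatorname{imax}([t_1]_\sigma,[t_2]_\sigma)$. Sublevels: for finite $E\subseteq\mathcal{X}$, $x\in\mathcal{X}$, $S\in\mathbb{N}$, $[A(E,x,S)]_\sigma$ is $0$ if some $y\in E$ has $\sigma(y)=0$ and $\sigma(x)+S$ otherwise; $[B(E,S)]_\sigma$ is $0$ if some $y\in E$ has $\sigma(y)=0$ and $S$ otherwise. $\mathcal{L}_s$ is the set of sublevels $A(E,x,S)$ with $x\in E$ and $B(E,S)$ with $S>0$. $\max$ of a finite family is evaluated pointwise (empty max has value $0$).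 $t_1\leqslant_{\mathcal{L}} t_2$ (resp. $=_{\mathcal{L}}$) means $[t_1]_\sigma\le[t_2]_\sigma$ (resp. $=$) for every valuation $\sigma$. Sublevels $u,v$ are incomparable if neither $u\leqslant_{\mathcal{L}} v$ nor $v\leqslant_{\mathcal{L}} u$. $\mathcal{L}_r$ (minimal representations) is the set of formal expressions $\max(u_1,\ldots,u_n)$ with $\{u_1,\ldots,u_n\}$ a finite set of pairwise incomparable elements of $\mathcal{L}_s$. -}

module Defs where

open import Data.List using (List; foldr; map)
open import Data.List.Membership.Propositional using (_∈_)
open import Data.List.Relation.Unary.All using (All)
open import Data.List.Relation.Unary.AllPairs using (AllPairs)
open import Data.List.Relation.Unary.Any using (any?)
import Data.List.Relation.Binary.Subset.Setoid as Subset
open import Data.Bool using (if_then_else_)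
open import Data.Nat using (ℕ; zero; suc; _+_; _⊔_; _≤_; _<_; _≟_)
open import Data.Product using (_×_; _,_)
open import Relation.Binary.Bundles using (Setoid)
open import Relation.Binary.PropositionalEquality using (_≡_; refl; sym; trans; setoid)
open import Relation.Nullary using (¬_; does)

-- Finite sets are represented by lists, compared by having the same elements
-- (up to the equality of the element setoid).

FinSet : ∀ {c ℓ} → Setoid c ℓ → Setoid _ _
FinSet S = record
  { Carrier       = List (Setoid.Carrier S)
  ; _≈_           = λ xs ys → xs ⊆ ys × ys ⊆ xs
  ; isEquivalence = record
    { refl  = (λ p → p) , (λ p → p)
    ; sym   = λ (f , g) → g , f
    ; trans = λ (f , g) (h , k) → (λ p → h (f p)) , (λ p → g (k p))
    }
  }
  where open Subset S using (_⊆_)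

imax : ℕ → ℕ → ℕ
imax i zero    = 0
imax i (suc j) = i ⊔ suc j

data ℒ (X : Set) : Set where
  var     : X → ℒ X
  `0      : ℒ X
  `s      : ℒ X → ℒ X
  `max    : ℒ X → ℒ X → ℒ X
  `imax   : ℒ X → ℒ X → ℒ X

data Sublevel (X : Set) : Set where
  A : (E : List X) (x : X) (S : ℕ) → Sublevel X
  B : (E : List X) (S : ℕ) → Sublevel X

-- Syntactic equality of sublevels, where E is a finite set rather than a list.

infix 4 _≈ₛ_

data _≈ₛ_ {X : Set} : Sublevel X → Sublevel X → Set where
  A : ∀ {E F x y S T} → Setoid._≈_ (FinSet (setoid X)) E F → x ≡ y → S ≡ T →
      A E x S ≈ₛ A F y T
  B : ∀ {E F S T} → Setoid._≈_ (FinSet (setoid X)) E F → S ≡ T →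
      B E S ≈ₛ B F T

sublevelSetoid : Set → Setoid _ _
sublevelSetoid X = record
  { Carrier       = Sublevel X
  ; _≈_           = _≈ₛ_
  ; isEquivalence = record { refl = λ {u} → ≈-refl u ; sym = ≈-sym ; trans = ≈-trans }
  }
  where
  module F = Setoid (FinSet (setoid X))

  ≈-refl : ∀ u → u ≈ₛ u
  ≈-refl (A E x S) = A (F.refl {E}) refl refl
  ≈-refl (B E S)   = B (F.refl {E}) refl

  ≈-sym : ∀ {u v} → u ≈ₛ v → v ≈ₛ u
  ≈-sym (A {E} {F} p q r) = A (F.sym {E} {F} p) (sym q) (sym r)
  ≈-sym (B {E} {F} p r)   = B (F.sym {E} {F} p) (sym r)

  ≈-trans : ∀ {u v w} → u ≈ₛ v → v ≈ₛ w → u ≈ₛ w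
  ≈-trans (A {E} {F} p q r) (A {_} {G} p′ q′ r′) =
    A (F.trans {E} {F} {G} p p′) (trans q q′) (trans r r′)
  ≈-trans (B {E} {F} p r) (B {_} {G} p′ r′) =
    B (F.trans {E} {F} {G} p p′) (trans r r′)

infix 4 _≋_

_≋_ : {X : Set} → List (Sublevel X) → List (Sublevel X) → Set
_≋_ {X} = Setoid._≈_ (FinSet (sublevelSetoid X))

Valuation : Set → Set
Valuation X = X → ℕ

⟦_⟧ : {X : Set} → ℒ X → Valuation X → ℕ
⟦ var x ⟧     σ = σ x
⟦ `0 ⟧        σ = 0
⟦ `s t ⟧      σ = ⟦ t ⟧ σ + 1
⟦ `max t u ⟧  σ = ⟦ t ⟧ σ ⊔ ⟦ u ⟧ σ
⟦ `imax t u ⟧ σ = imax (⟦ t ⟧ σ) (⟦ u ⟧ σ)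

⟦_⟧ₛ : {X : Set} → Sublevel X → Valuation X → ℕ
⟦ A E x S ⟧ₛ σ = if does (any? (λ y → σ y ≟ 0) E) then 0 else σ x + S
⟦ B E S ⟧ₛ   σ = if does (any? (λ y → σ y ≟ 0) E) then 0 else S

⟦max_⟧ : {X : Set} → List (Sublevel X) → Valuation X → ℕ
⟦max us ⟧ σ = foldr _⊔_ 0 (map (λ u → ⟦ u ⟧ₛ σ) us)

-- The semantic order and equality relate expressions of different syntactic
-- kinds (levels, sublevels, maxima), so they are stated on value functions.

infix 4 _≤ℒ_ _=ℒ_

_≤ℒ_ : {X : Set} → (Valuation X → ℕ) → (Valuation X → ℕ) → Set
f ≤ℒ g = ∀ σ → f σ ≤ g σ

_=ℒ_ : {X : Set} → (Valuation X → ℕ) → (Valuation X → ℕ) → Set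
f =ℒ g = ∀ σ → f σ ≡ g σ

Incomparable : {X : Set} → Sublevel X → Sublevel X → Set
Incomparable u v = ¬ (⟦ u ⟧ₛ ≤ℒ ⟦ v ⟧ₛ) × ¬ (⟦ v ⟧ₛ ≤ℒ ⟦ u ⟧ₛ)

data _∈ℒₛ {X : Set} : Sublevel X → Set where
  A : ∀ {E x S} → x ∈ E → A E x S ∈ℒₛ
  B : ∀ {E S} → 0 < S → B E S ∈ℒₛ

-- max(u₁,…,uₙ) ∈ ℒᵣ for the list u₁,…,uₙ. AllPairs ranges over pairs of
-- positions, so the list also enumerates its set without repetition.

max_∈ℒᵣ : {X : Set} → List (Sublevel X) → Set
max us ∈ℒᵣ = All _∈ℒₛ us × AllPairs Incomparable us

{-# OPTIONS --safe #-}

-- A sublevel u of ℒₛ has a probe valuation, vanishing off its guard E, equal to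
-- 1 on E, and, for A(E,x,S), to a large N at x. On this single valuation u
-- exceeds every v ∈ ℒₛ with u ≰ v, once N is large compared with v. Hence ≤ on
-- ℒₛ is decidable, and u ≤ max(v₁,…,vₙ) forces u ≤ vᵢ for some i; so two
-- antichains with the same maximum consist of the same sublevels. For existence,
-- levels are translated to maxima of sublevels (imax(u,v) is v together with u
-- guarded by the guard of v), and dominated sublevels are then dropped.
module Submission where

open import Defs
open import Data.Bool using (if_then_else_)
open import Data.List using (List; []; _∷_; _++_; map; filter)
open import Data.List.Extrema.Nat using (max; xs≤max)
open import Data.List.Membership.Propositional using (_∈_; find; lose)
open import Data.List.Membership.Propositional.Properties using (∈-++⁺ʳ)
open import Data.List.Relation.Binary.Subset.Propositional using (_⊆_)
open import Data.List.Relation.Unary.All as All using (All; []; _∷_)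
import Data.List.Relation.Unary.All.Properties as All
open import Data.List.Relation.Unary.AllPairs using (AllPairs; []; _∷_)
import Data.List.Relation.Unary.AllPairs.Properties as AllPairs
open import Data.List.Relation.Unary.Any as Any using (Any; here; there; any?)
open import Data.Nat using (ℕ; zero; suc; _+_; _⊔_; _≤_; _<_; z≤n; s≤s; _≟_; _≤?_)
open import Data.Nat.Properties
open import Data.Product using (_×_; _,_; ∃; ∃!; proj₁; proj₂)
open import Data.Sum using (inj₁; inj₂)
open import Function using (_∘_)
open import Function.Bundles using (_↣_)
open import Relation.Binary.Bundles using (Setoid)
open import Relation.Binary.Definitions using (DecidableEquality)
open import Relation.Binary.PropositionalEquality using (_≡_; refl; sym; trans; cong; cong₂; subst; module ≡-Reasoning)
open import Relation.Nullary using (¬_; Dec; yes; no; does; ¬?; contradiction)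
open import Relation.Nullary.Decidable using (via-injection)

private variable
  X : Set

-- Guarded values

-- The conditional of `⟦_⟧ₛ` with the guarded value abstracted, so that both kinds of sublevel
-- unfold to it by `refl`.
guard : Valuation X → List X → ℕ → ℕ
guard σ E n = if does (any? (λ y → σ y ≟ 0) E) then 0 else n

supp : Sublevel X → List X
supp (A E x S) = E
supp (B E S)   = E

body : Sublevel X → Valuation X → ℕ
body (A E x S) σ = σ x + S
body (B E S)   σ = S

⟦⟧ₛ-guard : (u : Sublevel X) (σ : Valuation X) → ⟦ u ⟧ₛ σ ≡ guard σ (supp u) (body u σ)
⟦⟧ₛ-guard (A E x S) σ = refl
⟦⟧ₛ-guard (B E S)   σ = refl

Positive : Valuation X → List X → Set
Positive σ E = ∀ {y} → y ∈ E → 0 < σ y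

guard-positive : ∀ {σ : Valuation X} {E} n → Positive σ E → guard σ E n ≡ n
guard-positive {σ = σ} {E} n pos with any? (λ y → σ y ≟ 0) E
... | no _ = refl
... | yes p with find p
...   | y , y∈E , σy≡0 = contradiction σy≡0 (>⇒≢ (pos y∈E))

guard>0⇒positive : ∀ {σ : Valuation X} {E} n → 0 < guard σ E n → Positive σ E
guard>0⇒positive {σ = σ} {E} n lt y∈E with any? (λ y → σ y ≟ 0) E
... | no ¬p = n≢0⇒n>0 (λ σy≡0 → ¬p (lose y∈E σy≡0))

guard≤ : ∀ (σ : Valuation X) E n → guard σ E n ≤ n
guard≤ σ E n with any? (λ y → σ y ≟ 0) E
... | yes _ = z≤n
... | no _  = ≤-refl

guard-++ : ∀ (σ : Valuation X) E F n → guard σ (E ++ F) n ≡ guard σ E (guard σ F n)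
guard-++ σ []      F n = refl
guard-++ σ (y ∷ E) F n with σ y
... | zero  = refl
... | suc _ = guard-++ σ E F n

⟦⟧ₛ-positive : ∀ (u : Sublevel X) {σ} → Positive σ (supp u) → ⟦ u ⟧ₛ σ ≡ body u σ
⟦⟧ₛ-positive u {σ} pos = trans (⟦⟧ₛ-guard u σ) (guard-positive _ pos)

⟦⟧ₛ>0⇒positive : ∀ (u : Sublevel X) {σ} → 0 < ⟦ u ⟧ₛ σ → Positive σ (supp u)
⟦⟧ₛ>0⇒positive u {σ} lt = guard>0⇒positive _ (subst (0 <_) (⟦⟧ₛ-guard u σ) lt)

⟦⟧ₛ≤body : ∀ (u : Sublevel X) σ → ⟦ u ⟧ₛ σ ≤ body u σ
⟦⟧ₛ≤body u σ = ≤-trans (≤-reflexive (⟦⟧ₛ-guard u σ)) (guard≤ σ (supp u) _)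

body>0 : ∀ {u : Sublevel X} {σ} → u ∈ℒₛ → Positive σ (supp u) → 0 < body u σ
body>0 (A {S = S} x∈E) pos = ≤-trans (pos x∈E) (m≤m+n _ S)
body>0 (B S>0)         pos = S>0

⟦⟧ₛ>0 : ∀ {u : Sublevel X} {σ} → u ∈ℒₛ → Positive σ (supp u) → 0 < ⟦ u ⟧ₛ σ
⟦⟧ₛ>0 {u = u} u∈ pos = subst (0 <_) (sym (⟦⟧ₛ-positive u pos)) (body>0 u∈ pos)

-- Syntactic comparison of sublevels

infix 4 _⊑_

-- Agrees with `≤ℒ` on ℒₛ. No rule leads from `A` to `B`, since the variable is unbounded; in `B⊑A`
-- the bound is `suc T` because an open guard containing `y` makes `y` at least 1.
data _⊑_ {X : Set} : Sublevel X → Sublevel X → Set where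
  A⊑A : ∀ {E F x S T} → F ⊆ E → S ≤ T → A E x S ⊑ A F x T
  B⊑B : ∀ {E F S T} → F ⊆ E → S ≤ T → B E S ⊑ B F T
  B⊑A : ∀ {E F y S T} → F ⊆ E → S ≤ suc T → B E S ⊑ A F y T

-- Where `u` is 0 there is nothing to show; elsewhere the guard of `u` is open, hence so is the
-- smaller guard of `v`, and only the bodies matter.
≤ℒ-intro : ∀ (u v : Sublevel X) → supp v ⊆ supp u →
           (∀ {σ} → Positive σ (supp u) → body u σ ≤ body v σ) → ⟦ u ⟧ₛ ≤ℒ ⟦ v ⟧ₛ
≤ℒ-intro u v F⊆E le σ with ⟦ u ⟧ₛ σ in eq
... | zero  = z≤n
... | suc n = begin
  suc n     ≡⟨ eq ⟨
  ⟦ u ⟧ₛ σ  ≡⟨ ⟦⟧ₛ-positive u pos ⟩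
  body u σ  ≤⟨ le pos ⟩
  body v σ  ≡⟨ ⟦⟧ₛ-positive v (pos ∘ F⊆E) ⟨
  ⟦ v ⟧ₛ σ  ∎
  where
  open ≤-Reasoning
  pos : Positive σ (supp u)
  pos = ⟦⟧ₛ>0⇒positive u (subst (0 <_) (sym eq) (s≤s z≤n))

⊑⇒≤ℒ : ∀ {u v : Sublevel X} → v ∈ℒₛ → u ⊑ v → ⟦ u ⟧ₛ ≤ℒ ⟦ v ⟧ₛ
⊑⇒≤ℒ {u = u} {v} v∈ (A⊑A {x = x} F⊆E S≤T) = ≤ℒ-intro u v F⊆E (λ {σ} _ → +-monoʳ-≤ (σ x) S≤T)
⊑⇒≤ℒ {u = u} {v} v∈ (B⊑B F⊆E S≤T) = ≤ℒ-intro u v F⊆E (λ _ → S≤T)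
⊑⇒≤ℒ {u = u} {v} (A y∈F) (B⊑A {T = T} F⊆E S≤1+T) =
  ≤ℒ-intro u v F⊆E (λ pos → ≤-trans S≤1+T (+-monoˡ-≤ T (pos (F⊆E y∈F))))

-- The mixed rule `B⊑A` has no converse, so both sublevels are of the same kind.
⊑-antisym : ∀ {u v : Sublevel X} → u ⊑ v → v ⊑ u → u ≈ₛ v
⊑-antisym (A⊑A F⊆E S≤T) (A⊑A E⊆F T≤S) = A (E⊆F , F⊆E) refl (≤-antisym S≤T T≤S)
⊑-antisym (B⊑B F⊆E S≤T) (B⊑B E⊆F T≤S) = B (E⊆F , F⊆E) (≤-antisym S≤T T≤S)

-- Maxima of sublevels

⟦max⟧-++ : ∀ (us vs : List (Sublevel X)) σ → ⟦max us ++ vs ⟧ σ ≡ ⟦max us ⟧ σ ⊔ ⟦max vs ⟧ σ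
⟦max⟧-++ []       vs σ = refl
⟦max⟧-++ (u ∷ us) vs σ =
  trans (cong (⟦ u ⟧ₛ σ ⊔_) (⟦max⟧-++ us vs σ)) (sym (⊔-assoc (⟦ u ⟧ₛ σ) _ _))

∈⇒≤⟦max⟧ : ∀ {u : Sublevel X} {us} → u ∈ us → ⟦ u ⟧ₛ ≤ℒ ⟦max us ⟧
∈⇒≤⟦max⟧ (here refl)          σ = m≤m⊔n _ _
∈⇒≤⟦max⟧ (there {x = v} u∈us) σ = ≤-trans (∈⇒≤⟦max⟧ u∈us σ) (m≤n⊔m (⟦ v ⟧ₛ σ) _)

-- The maximum is attained by some member; positivity of `n` rules out the empty list.
≤⟦max⟧⇒Any : ∀ {n σ} (vs : List (Sublevel X)) → 0 < n → n ≤ ⟦max vs ⟧ σ → Any (λ v → n ≤ ⟦ v ⟧ₛ σ) vs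
≤⟦max⟧⇒Any []       n>0 n≤ = contradiction n≤ (<⇒≱ n>0)
≤⟦max⟧⇒Any {σ = σ} (v ∷ vs) n>0 n≤ with ⊔-sel (⟦ v ⟧ₛ σ) (⟦max vs ⟧ σ)
... | inj₁ eq = here (subst (_ ≤_) eq n≤)
... | inj₂ eq = there (≤⟦max⟧⇒Any vs n>0 (subst (_ ≤_) eq n≤))

antichain-≡ : ∀ {us : List (Sublevel X)} {u v} → AllPairs Incomparable us →
              u ∈ us → v ∈ us → ⟦ u ⟧ₛ ≤ℒ ⟦ v ⟧ₛ → u ≡ v
antichain-≡ (_ ∷ _)   (here refl) (here refl) _   = refl
antichain-≡ (i ∷ _)   (here refl) (there v∈)  u≤v = contradiction u≤v (proj₁ (All.lookup i v∈))
antichain-≡ (i ∷ _)   (there u∈)  (here refl) u≤v = contradiction u≤v (proj₂ (All.lookup i u∈))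
antichain-≡ (_ ∷ ips) (there u∈)  (there v∈)  u≤v = antichain-≡ ips u∈ v∈ u≤v

-- Translation of levels

sucₛ : Sublevel X → Sublevel X
sucₛ (A E x S) = A E x (suc S)
sucₛ (B E S)   = B E (suc S)

sucₛ-∈ℒₛ : ∀ {u : Sublevel X} → u ∈ℒₛ → sucₛ u ∈ℒₛ
sucₛ-∈ℒₛ (A x∈E) = A x∈E
sucₛ-∈ℒₛ (B _)   = B (s≤s z≤n)

guard-suc : ∀ (σ : Valuation X) E n → 1 ⊔ guard σ E (suc n) ≡ suc (guard σ E n)
guard-suc σ E n with any? (λ y → σ y ≟ 0) E
... | yes _ = refl
... | no _  = refl

⟦sucₛ⟧ : ∀ (u : Sublevel X) σ → 1 ⊔ ⟦ sucₛ u ⟧ₛ σ ≡ suc (⟦ u ⟧ₛ σ)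
⟦sucₛ⟧ (A E x S) σ =
  trans (cong (λ n → 1 ⊔ guard σ E n) (+-suc (σ x) S)) (guard-suc σ E (σ x + S))
⟦sucₛ⟧ (B E S)   σ = guard-suc σ E S

-- `B [] 1` is the constant 1: where the guard of `u` is closed, `sucₛ u` is still 0 while the
-- successor is 1.
sucs : List (Sublevel X) → List (Sublevel X)
sucs us = B [] 1 ∷ map sucₛ us

⟦max-sucs⟧ : ∀ (us : List (Sublevel X)) σ → ⟦max sucs us ⟧ σ ≡ suc (⟦max us ⟧ σ)
⟦max-sucs⟧ []       σ = refl
⟦max-sucs⟧ (u ∷ us) σ = begin
  1 ⊔ (a ⊔ b)        ≡⟨ ⊔-assoc 1 a b ⟨
  (1 ⊔ a) ⊔ b        ≡⟨ cong (_⊔ b) (⟦sucₛ⟧ u σ) ⟩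
  -- `⟦sucₛ⟧` has used up the 1; `suc c` absorbs a fresh copy, which the induction hypothesis needs.
  suc c ⊔ b          ≡⟨ cong (_⊔ b) (m≥n⇒m⊔n≡m {suc c} {1} (s≤s z≤n)) ⟨
  (suc c ⊔ 1) ⊔ b    ≡⟨ ⊔-assoc (suc c) 1 b ⟩
  suc c ⊔ (1 ⊔ b)    ≡⟨ cong (suc c ⊔_) (⟦max-sucs⟧ us σ) ⟩
  suc (c ⊔ ⟦max us ⟧ σ)  ∎
  where
  open ≡-Reasoning
  a b c : ℕ
  a = ⟦ sucₛ u ⟧ₛ σ
  b = ⟦max map sucₛ us ⟧ σ
  c = ⟦ u ⟧ₛ σ

restrict : List X → Sublevel X → Sublevel X
restrict F (A E x S) = A (F ++ E) x S
restrict F (B E S)   = B (F ++ E) S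

restrict-∈ℒₛ : ∀ (F : List X) {u} → u ∈ℒₛ → restrict F u ∈ℒₛ
restrict-∈ℒₛ F (A x∈E) = A (∈-++⁺ʳ F x∈E)
restrict-∈ℒₛ F (B S>0) = B S>0

⟦restrict⟧ : ∀ (F : List X) u σ → ⟦ restrict F u ⟧ₛ σ ≡ guard σ F (⟦ u ⟧ₛ σ)
⟦restrict⟧ F (A E x S) σ = guard-++ σ F E (σ x + S)
⟦restrict⟧ F (B E S)   σ = guard-++ σ F E S

guard-⊔ : ∀ (σ : Valuation X) F m n → guard σ F m ⊔ guard σ F n ≡ guard σ F (m ⊔ n)
guard-⊔ σ F m n with any? (λ y → σ y ≟ 0) F
... | yes _ = refl
... | no _  = refl

guard-0 : ∀ (σ : Valuation X) F → guard σ F 0 ≡ 0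
guard-0 σ F = n≤0⇒n≡0 (guard≤ σ F 0)

⟦max-restrict⟧ : ∀ (F : List X) us σ → ⟦max map (restrict F) us ⟧ σ ≡ guard σ F (⟦max us ⟧ σ)
⟦max-restrict⟧ F []       σ = sym (guard-0 σ F)
⟦max-restrict⟧ F (u ∷ us) σ =
  trans (cong₂ _⊔_ (⟦restrict⟧ F u σ) (⟦max-restrict⟧ F us σ)) (guard-⊔ σ F _ _)

imax-⊔ : ∀ m n o → imax m (n ⊔ o) ≡ imax m n ⊔ imax m o
imax-⊔ m zero    o       = refl
imax-⊔ m (suc n) zero    = sym (⊔-identityʳ _)
imax-⊔ m (suc n) (suc o) = begin
  m ⊔ (a ⊔ b)        ≡⟨ cong (_⊔ (a ⊔ b)) (⊔-idem m) ⟨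
  (m ⊔ m) ⊔ (a ⊔ b)  ≡⟨ ⊔-assoc m m (a ⊔ b) ⟩
  m ⊔ (m ⊔ (a ⊔ b))  ≡⟨ cong (m ⊔_) (⊔-assoc m a b) ⟨
  m ⊔ ((m ⊔ a) ⊔ b)  ≡⟨ cong (λ k → m ⊔ (k ⊔ b)) (⊔-comm m a) ⟩
  m ⊔ ((a ⊔ m) ⊔ b)  ≡⟨ cong (m ⊔_) (⊔-assoc a m b) ⟩
  m ⊔ (a ⊔ (m ⊔ b))  ≡⟨ ⊔-assoc m a (m ⊔ b) ⟨
  (m ⊔ a) ⊔ (m ⊔ b)  ∎
  where
  open ≡-Reasoning
  a b : ℕ
  a = suc n
  b = suc o

imaxₛ : List (Sublevel X) → Sublevel X → List (Sublevel X)
imaxₛ us v = v ∷ map (restrict (supp v)) us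

-- A member of ℒₛ is positive exactly where its guard is open, so restricting `us` by `supp v`
-- reproduces the test for 0 in `imax`.
⟦max-imaxₛ⟧ : ∀ (us : List (Sublevel X)) {v} → v ∈ℒₛ → ∀ σ →
              ⟦max imaxₛ us v ⟧ σ ≡ imax (⟦max us ⟧ σ) (⟦ v ⟧ₛ σ)
⟦max-imaxₛ⟧ us {v} v∈ σ =
  trans (cong (⟦ v ⟧ₛ σ ⊔_) (⟦max-restrict⟧ (supp v) us σ)) (guarded (⟦max us ⟧ σ))
  where
  guarded : ∀ m → ⟦ v ⟧ₛ σ ⊔ guard σ (supp v) m ≡ imax m (⟦ v ⟧ₛ σ)
  guarded m with ⟦ v ⟧ₛ σ in eq
  ... | suc n = trans (cong (suc n ⊔_) (guard-positive m pos)) (⊔-comm (suc n) m)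
    where
    pos : Positive σ (supp v)
    pos = ⟦⟧ₛ>0⇒positive v (subst (0 <_) (sym eq) (s≤s z≤n))
  ... | zero with guard σ (supp v) m in eq′
  ...   | zero  = refl
  ...   | suc _ = contradiction eq (>⇒≢ (⟦⟧ₛ>0 v∈
                    (guard>0⇒positive m (subst (0 <_) (sym eq′) (s≤s z≤n)))))

-- One block per member of the second list, since `imax` distributes over the maximum in its second
-- argument.
imaxs : List (Sublevel X) → List (Sublevel X) → List (Sublevel X)
imaxs us []       = []
imaxs us (v ∷ vs) = imaxₛ us v ++ imaxs us vs

imaxs-∈ℒₛ : ∀ {us vs : List (Sublevel X)} → All _∈ℒₛ us → All _∈ℒₛ vs → All _∈ℒₛ (imaxs us vs)
imaxs-∈ℒₛ us∈ []         = []
imaxs-∈ℒₛ us∈ (v∈ ∷ vs∈) =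
  All.++⁺ (v∈ ∷ All.map⁺ (All.map (restrict-∈ℒₛ _) us∈)) (imaxs-∈ℒₛ us∈ vs∈)

⟦max-imaxs⟧ : ∀ (us : List (Sublevel X)) {vs} → All _∈ℒₛ vs → ∀ σ →
              ⟦max imaxs us vs ⟧ σ ≡ imax (⟦max us ⟧ σ) (⟦max vs ⟧ σ)
⟦max-imaxs⟧ us []                  σ = refl
⟦max-imaxs⟧ us {v ∷ vs} (v∈ ∷ vs∈) σ = begin
  ⟦max imaxₛ us v ++ imaxs us vs ⟧ σ             ≡⟨ ⟦max⟧-++ (imaxₛ us v) (imaxs us vs) σ ⟩
  ⟦max imaxₛ us v ⟧ σ ⊔ ⟦max imaxs us vs ⟧ σ     ≡⟨ cong₂ _⊔_ (⟦max-imaxₛ⟧ us v∈ σ) (⟦max-imaxs⟧ us vs∈ σ) ⟩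
  imax m (⟦ v ⟧ₛ σ) ⊔ imax m (⟦max vs ⟧ σ)       ≡⟨ imax-⊔ m (⟦ v ⟧ₛ σ) (⟦max vs ⟧ σ) ⟨
  imax m (⟦max v ∷ vs ⟧ σ)                       ∎
  where
  open ≡-Reasoning
  m : ℕ
  m = ⟦max us ⟧ σ

translate : ℒ X → List (Sublevel X)
translate (var x)     = A (x ∷ []) x 0 ∷ []
translate `0          = []
translate (`s t)      = sucs (translate t)
translate (`max t u)  = translate t ++ translate u
translate (`imax t u) = imaxs (translate t) (translate u)

translate-∈ℒₛ : (t : ℒ X) → All _∈ℒₛ (translate t)
translate-∈ℒₛ (var x)     = A (here refl) ∷ []
translate-∈ℒₛ `0          = []
translate-∈ℒₛ (`s t)      = B (s≤s z≤n) ∷ All.map⁺ (All.map sucₛ-∈ℒₛ (translate-∈ℒₛ t))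
translate-∈ℒₛ (`max t u)  = All.++⁺ (translate-∈ℒₛ t) (translate-∈ℒₛ u)
translate-∈ℒₛ (`imax t u) = imaxs-∈ℒₛ (translate-∈ℒₛ t) (translate-∈ℒₛ u)

⟦translate⟧ : (t : ℒ X) → ⟦ t ⟧ =ℒ ⟦max translate t ⟧
⟦translate⟧ (var x) σ with σ x
... | zero  = refl
... | suc n = cong suc (sym (+-identityʳ n))
⟦translate⟧ `0          σ = refl
⟦translate⟧ (`s t)      σ = begin
  ⟦ t ⟧ σ + 1                  ≡⟨ +-comm (⟦ t ⟧ σ) 1 ⟩
  suc (⟦ t ⟧ σ)                ≡⟨ cong suc (⟦translate⟧ t σ) ⟩
  suc (⟦max translate t ⟧ σ)   ≡⟨ ⟦max-sucs⟧ (translate t) σ ⟨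
  ⟦max sucs (translate t) ⟧ σ  ∎
  where open ≡-Reasoning
⟦translate⟧ (`max t u)  σ =
  trans (cong₂ _⊔_ (⟦translate⟧ t σ) (⟦translate⟧ u σ))
        (sym (⟦max⟧-++ (translate t) (translate u) σ))
⟦translate⟧ (`imax t u) σ =
  trans (cong₂ imax (⟦translate⟧ t σ) (⟦translate⟧ u σ))
        (sym (⟦max-imaxs⟧ (translate t) (translate-∈ℒₛ u) σ))

module _ {X : Set} (_≟ˣ_ : DecidableEquality X) where

  open import Data.List.Membership.DecPropositional _≟ˣ_ using (_∈?_)

  -- Probe valuations

  -- The value 1 keeps guards open at least cost: `A F y T` with `y` off the peak gets at most
  -- `1 + T`.
  peak : Sublevel X → ℕ → Valuation X
  peak (A E x S) N y = if does (y ≟ˣ x) then N else 1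
  peak (B E S)   N y = 1

  probe : Sublevel X → ℕ → Valuation X
  probe u N y = if does (y ∈? supp u) then peak u N y else 0

  peak>0 : ∀ u {N} → 0 < N → ∀ y → 0 < peak u N y
  peak>0 (A E x S) N>0 y with y ≟ˣ x
  ... | yes _ = N>0
  ... | no _  = s≤s z≤n
  peak>0 (B E S)   N>0 y = s≤s z≤n

  probe-∈ : ∀ u N {y} → y ∈ supp u → probe u N y ≡ peak u N y
  probe-∈ u N {y} y∈ with y ∈? supp u
  ... | yes _  = refl
  ... | no y∉  = contradiction y∈ y∉

  probe>0⇒∈ : ∀ u N {y} → 0 < probe u N y → y ∈ supp u
  probe>0⇒∈ u N {y} lt with y ∈? supp u
  ... | yes y∈ = y∈

  peak-self : ∀ {E x S} N → peak (A E x S) N x ≡ N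
  peak-self {x = x} N with x ≟ˣ x
  ... | yes _  = refl
  ... | no x≢x = contradiction refl x≢x

  -- Strictly above the value of the sublevel on any probe that does not peak at its variable: at
  -- most `1 + S` for `A`, at most `S` for `B`.
  bound : Sublevel X → ℕ
  bound (A E x S) = 2 + S
  bound (B E S)   = suc S

  bound>0 : ∀ v → 0 < bound v
  bound>0 (A E x S) = s≤s z≤n
  bound>0 (B E S)   = s≤s z≤n

  module _ (u v : Sublevel X) (N : ℕ) (u∈ : u ∈ℒₛ) (N>0 : 0 < N) where

    probe-positive : Positive (probe u N) (supp u)
    probe-positive y∈ = subst (0 <_) (sym (probe-∈ u N y∈)) (peak>0 u N>0 _)

    -- `u` is positive on its own probe, so `v` is too; the guard of `v` is then open there, and the
    -- probe vanishes off `supp u`.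
    probe-supp : ⟦ u ⟧ₛ (probe u N) ≤ ⟦ v ⟧ₛ (probe u N) → supp v ⊆ supp u
    probe-supp le = probe>0⇒∈ u N ∘ ⟦⟧ₛ>0⇒positive v (≤-trans (⟦⟧ₛ>0 u∈ probe-positive) le)

    probe-body : ⟦ u ⟧ₛ (probe u N) ≤ ⟦ v ⟧ₛ (probe u N) →
                 body u (probe u N) ≤ body v (probe u N)
    probe-body le = begin
      body u (probe u N)  ≡⟨ ⟦⟧ₛ-positive u probe-positive ⟨
      ⟦ u ⟧ₛ (probe u N)  ≤⟨ le ⟩
      ⟦ v ⟧ₛ (probe u N)  ≤⟨ ⟦⟧ₛ≤body v (probe u N) ⟩
      body v (probe u N)  ∎
      where open ≤-Reasoning

  -- If `u` peaks at `x`, then `N` is too large for any `v` but an `A` with the same variable, where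
  -- `N` cancels. If `u` is a `B`, its probe is 1 on the guard and the inequality of bodies is
  -- already the required one.
  compare-bodies : ∀ {u v N} → u ∈ℒₛ → v ∈ℒₛ → bound v ≤ N → supp v ⊆ supp u →
                   body u (probe u N) ≤ body v (probe u N) → u ⊑ v
  compare-bodies {u@(A E x S)} {A F y T} {N} (A x∈E) (A y∈F) N≥ F⊆E le
    rewrite probe-∈ u N x∈E | probe-∈ u N (F⊆E y∈F) | peak-self {E} {x} {S} N
    with y ≟ˣ x
  ... | yes refl = A⊑A F⊆E (+-cancelˡ-≤ N S T le)
  ... | no _     = contradiction (≤-trans (m≤m+n N S) le) (<⇒≱ N≥)
  compare-bodies {u@(A E x S)} {B F T} {N} (A x∈E) (B _) N≥ F⊆E le
    rewrite probe-∈ u N x∈E | peak-self {E} {x} {S} N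
    = contradiction (≤-trans (m≤m+n N S) le) (<⇒≱ N≥)
  compare-bodies {u@(B E S)} {A F y T} {N} (B _) (A y∈F) N≥ F⊆E le
    rewrite probe-∈ u N (F⊆E y∈F) = B⊑A F⊆E le
  compare-bodies {B E S} {B F T} (B _) (B _) N≥ F⊆E le = B⊑B F⊆E le

  -- `N` is only bounded from below, so one probe of `u` serves for several `v` at once.
  probe-complete : ∀ {u v N} → u ∈ℒₛ → v ∈ℒₛ → bound v ≤ N →
                   ⟦ u ⟧ₛ (probe u N) ≤ ⟦ v ⟧ₛ (probe u N) → u ⊑ v
  probe-complete {u} {v} {N} u∈ v∈ N≥ le =
    compare-bodies u∈ v∈ N≥ (probe-supp u v N u∈ N>0 le) (probe-body u v N u∈ N>0 le)
    where
    N>0 : 0 < N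
    N>0 = ≤-trans (bound>0 v) N≥

  ≤ℒ⇒⊑ : ∀ {u v} → u ∈ℒₛ → v ∈ℒₛ → ⟦ u ⟧ₛ ≤ℒ ⟦ v ⟧ₛ → u ⊑ v
  ≤ℒ⇒⊑ {u} {v} u∈ v∈ u≤v = probe-complete u∈ v∈ ≤-refl (u≤v (probe u (bound v)))

  -- Uniqueness

  -- On a probe of `u` the maximum is attained by some `v`; this one inequality yields `u ⊑ v`,
  -- hence the order on all valuations.
  ≤⟦max⟧⇒Any-≤ℒ : ∀ {u vs} → u ∈ℒₛ → All _∈ℒₛ vs → ⟦ u ⟧ₛ ≤ℒ ⟦max vs ⟧ →
                  ∃ λ v → v ∈ vs × ⟦ u ⟧ₛ ≤ℒ ⟦ v ⟧ₛ
  ≤⟦max⟧⇒Any-≤ℒ {u} {vs} u∈ vs∈ u≤ =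
    let v , v∈vs , le = find (≤⟦max⟧⇒Any vs u>0 (u≤ (probe u N)))
        v∈ = All.lookup vs∈ v∈vs
    in v , v∈vs , ⊑⇒≤ℒ v∈ (probe-complete u∈ v∈ (≤-trans (bound≤ v∈vs) (n≤1+n _)) le)
    where
    N : ℕ
    -- Large enough for every member of `vs`; the `suc` keeps `N` positive when `vs` is empty.
    N = suc (max 0 (map bound vs))
    bound≤ : ∀ {v} → v ∈ vs → bound v ≤ max 0 (map bound vs)
    bound≤ = All.lookup (All.map⁻ (xs≤max 0 (map bound vs)))
    u>0 : 0 < ⟦ u ⟧ₛ (probe u N)
    u>0 = ⟦⟧ₛ>0 u∈ (probe-positive u u N u∈ (s≤s z≤n))

  open Setoid (sublevelSetoid X) using () renaming (trans to ≈ₛ-trans)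
  open import Data.List.Relation.Binary.Subset.Setoid (sublevelSetoid X) using () renaming (_⊆_ to _⊆ₛ_)
  open import Data.List.Membership.Setoid (sublevelSetoid X) using () renaming (_∈_ to _∈ₛ_)

  -- u ≤ v ≤ u′ with u, u′ in the antichain us collapses to u = v.
  ⟦max⟧-reflects-⊆ : ∀ {us vs} → max us ∈ℒᵣ → max vs ∈ℒᵣ → ⟦max us ⟧ =ℒ ⟦max vs ⟧ → us ⊆ₛ vs
  ⟦max⟧-reflects-⊆ {us} {vs} (us∈ , us-anti) (vs∈ , _) eq x∈us =
    -- `x` belongs to `us` only up to `≈ₛ`, so the match found for the actual member `u` is carried
    -- over by transitivity.
    let u∈ₛvs , x≈u = All.lookupAny (All.tabulate matched) x∈us
    in Any.map (≈ₛ-trans x≈u) u∈ₛvs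
    where
    matched : ∀ {u} → u ∈ us → u ∈ₛ vs
    matched {u} u∈us
      with u∈ ← All.lookup us∈ u∈us
      with v , v∈vs , u≤v ← ≤⟦max⟧⇒Any-≤ℒ u∈ vs∈ (λ σ → ≤-trans (∈⇒≤⟦max⟧ u∈us σ) (≤-reflexive (eq σ)))
      with v∈ ← All.lookup vs∈ v∈vs
      with u′ , u′∈us , v≤u′ ← ≤⟦max⟧⇒Any-≤ℒ v∈ us∈ (λ σ → ≤-trans (∈⇒≤⟦max⟧ v∈vs σ) (≤-reflexive (sym (eq σ))))
      with refl ← antichain-≡ us-anti u∈us u′∈us (λ σ → ≤-trans (u≤v σ) (v≤u′ σ))
      = Any.map (λ { refl → ⊑-antisym (≤ℒ⇒⊑ u∈ v∈ u≤v) (≤ℒ⇒⊑ v∈ u∈ v≤u′) }) v∈vs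

  -- Removal of dominated sublevels

  -- Equivalent to ⟦ u ⟧ₛ ≤ℒ ⟦ v ⟧ₛ on ℒₛ, but decidable for arbitrary sublevels.
  infix 4 _≼_ _≼?_

  _≼_ : Sublevel X → Sublevel X → Set
  u ≼ v = ⟦ u ⟧ₛ (probe u (bound v)) ≤ ⟦ v ⟧ₛ (probe u (bound v))

  -- Abstract so that case splits on u ≼? v are seen by filter, whose test would
  -- otherwise reduce to a boolean comparison of numbers.
  abstract
    _≼?_ : ∀ u v → Dec (u ≼ v)
    u ≼? v = _ ≤? _

  ≤ℒ⇒≼ : ∀ u v → ⟦ u ⟧ₛ ≤ℒ ⟦ v ⟧ₛ → u ≼ v
  ≤ℒ⇒≼ u v u≤v = u≤v (probe u (bound v))

  ≼⇒≤ℒ : ∀ {u v} → u ∈ℒₛ → v ∈ℒₛ → u ≼ v → ⟦ u ⟧ₛ ≤ℒ ⟦ v ⟧ₛ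
  ≼⇒≤ℒ u∈ v∈ u≼v = ⊑⇒≤ℒ v∈ (probe-complete u∈ v∈ ≤-refl u≼v)

  prune : Sublevel X → List (Sublevel X) → List (Sublevel X)
  prune u = filter (λ v → ¬? (v ≼? u))

  -- Every dropped `v` is absorbed by `u`, which stays in the maximum.
  ⟦max-prune⟧ : ∀ {u} → u ∈ℒₛ → ∀ {vs} → All _∈ℒₛ vs → ∀ σ →
                ⟦ u ⟧ₛ σ ⊔ ⟦max prune u vs ⟧ σ ≡ ⟦ u ⟧ₛ σ ⊔ ⟦max vs ⟧ σ
  ⟦max-prune⟧ u∈ [] σ = refl
  ⟦max-prune⟧ {u} u∈ {v ∷ vs} (v∈ ∷ vs∈) σ with v ≼? u
  ... | yes v≼u = begin
    a ⊔ ⟦max prune u vs ⟧ σ  ≡⟨ ⟦max-prune⟧ u∈ vs∈ σ ⟩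
    a ⊔ c                    ≡⟨ cong (_⊔ c) (m≥n⇒m⊔n≡m (≼⇒≤ℒ v∈ u∈ v≼u σ)) ⟨
    (a ⊔ b) ⊔ c              ≡⟨ ⊔-assoc a b c ⟩
    a ⊔ (b ⊔ c)              ∎
    where
    open ≡-Reasoning
    a b c : ℕ
    a = ⟦ u ⟧ₛ σ
    b = ⟦ v ⟧ₛ σ
    c = ⟦max vs ⟧ σ
  ... | no _ = begin
    a ⊔ (b ⊔ p)  ≡⟨ swap p ⟩
    b ⊔ (a ⊔ p)  ≡⟨ cong (b ⊔_) (⟦max-prune⟧ u∈ vs∈ σ) ⟩
    b ⊔ (a ⊔ c)  ≡⟨ swap c ⟨
    a ⊔ (b ⊔ c)  ∎
    where
    open ≡-Reasoning
    a b c p : ℕ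
    a = ⟦ u ⟧ₛ σ
    b = ⟦ v ⟧ₛ σ
    c = ⟦max vs ⟧ σ
    p = ⟦max prune u vs ⟧ σ
    swap : ∀ k → a ⊔ (b ⊔ k) ≡ b ⊔ (a ⊔ k)
    swap k = trans (sym (⊔-assoc a b k)) (trans (cong (_⊔ k) (⊔-comm a b)) (⊔-assoc b a k))

  -- If some member dominates `u`, the list stays as it is. Otherwise the failed search gives one
  -- half of incomparability and pruning the other.
  insert : ∀ {u vs} → u ∈ℒₛ → max vs ∈ℒᵣ →
           ∃ λ ws → max ws ∈ℒᵣ × ⟦max u ∷ vs ⟧ =ℒ ⟦max ws ⟧
  insert {u} {vs} u∈ (vs∈ , anti) with any? (u ≼?_) vs
  ... | yes p =
    let v , v∈vs , u≼v = find p
        u≤v = ≼⇒≤ℒ u∈ (All.lookup vs∈ v∈vs) u≼v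
    in vs , (vs∈ , anti) , λ σ → m≤n⇒m⊔n≡n (≤-trans (u≤v σ) (∈⇒≤⟦max⟧ v∈vs σ))
  ... | no ¬p = u ∷ prune u vs
    , (u∈ ∷ All.filter⁺ P? vs∈ , All.zip (u≰ , ≰u) ∷ AllPairs.filter⁺ P? anti)
    , λ σ → sym (⟦max-prune⟧ u∈ vs∈ σ)
    where
    P? : ∀ v → Dec (¬ v ≼ u)
    P? v = ¬? (v ≼? u)
    u≰ : All (λ v → ¬ ⟦ u ⟧ₛ ≤ℒ ⟦ v ⟧ₛ) (prune u vs)
    u≰ = All.filter⁺ P? (All.map (λ {v} ¬u≼v → ¬u≼v ∘ ≤ℒ⇒≼ u v) (All.¬Any⇒All¬ vs ¬p))
    ≰u : All (λ v → ¬ ⟦ v ⟧ₛ ≤ℒ ⟦ u ⟧ₛ) (prune u vs)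
    ≰u = All.map (λ {v} ¬v≼u → ¬v≼u ∘ ≤ℒ⇒≼ v u) (All.all-filter P? vs)

  minimise : ∀ {us} → All _∈ℒₛ us → ∃ λ vs → max vs ∈ℒᵣ × ⟦max us ⟧ =ℒ ⟦max vs ⟧
  minimise [] = [] , ([] , []) , λ σ → refl
  minimise {u ∷ us} (u∈ ∷ us∈) =
    let vs , vs∈ , us=vs = minimise us∈
        ws , ws∈ , eq    = insert u∈ vs∈
    in ws , ws∈ , λ σ → trans (cong (⟦ u ⟧ₛ σ ⊔_) (us=vs σ)) (eq σ)

theorem35 : (X : Set) → (X ↣ ℕ) → (t : ℒ X) →
    ∃! _≋_ (λ (us : List (Sublevel X)) → (max us ∈ℒᵣ) × (⟦ t ⟧ =ℒ ⟦max us ⟧))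
theorem35 X X↣ℕ t =
  let us , us∈ , eq = minimise _≟ˣ_ (translate-∈ℒₛ t)
      t=us σ = trans (⟦translate⟧ t σ) (eq σ)
  in us , (us∈ , t=us) , λ (vs∈ , t=vs) →
     let us=vs σ = trans (sym (t=us σ)) (t=vs σ)
     in ⟦max⟧-reflects-⊆ _≟ˣ_ us∈ vs∈ us=vs
      , ⟦max⟧-reflects-⊆ _≟ˣ_ vs∈ us∈ (λ σ → sym (us=vs σ))
  where
  -- The injection into ℕ decides equality of variables, on which the probes are built.
  _≟ˣ_ : DecidableEquality X
  _≟ˣ_ = via-injection X↣ℕ _≟_
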